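{- For all integers $n,k$ with $1\le k\le n-1$, $$\frac{d_n^{k-1}}{\binom{n}{k-1}}\cdot\frac{d_n^{k+1}}{\binom{n}{k+1}}\ \ge\ \left(\frac{d_n^k}{\binom{n}{k}}\right)^2,$$ or equivalently, $$(n-k+1)(k+1)\,d_n^{k-1}d_n^{k+1}\ \ge\ k(n-k)\left(d_n^k\right)^2.$$
   Context: Euler's difference table $(e_n^k)_{0\le k\le n}$ (for integers $n\ge 0$) is defined by $e_n^n=n!$ for $n\ge 0$ and $e_n^{k-1}=e_n^k-e_{n-1}^{k-1}$ for $1\le k\le n$. Define $d_n^k=e_n^k/k!$ for $0\le k\le n$. -}

module Defs where

open import Data.Nat.Base as ℕ using (ℕ; zero; suc; _∸_; _≤_; z≤n; s≤s; _!)
import Data.Nat.Properties as ℕ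
open import Data.Nat.Combinatorics using (_C_; nCn≡1; nCk≡nC[n∸k]; nCk+nC[k+1]≡[n+1]C[k+1])
open import Data.Integer.Base as ℤ using (ℤ; +_)
open import Data.Rational.Base as ℚ using (ℚ; _/_; _÷_)
import Data.Rational.Properties as ℚ
open import Relation.Binary.PropositionalEquality using (_≡_; refl; sym; trans; cong; subst)

-- eDiag j k is the entry e_{k+j}^k.  Indexing by the distance j = n - k from the
-- diagonal makes the recurrence e_n^k = e_n^{k+1} - e_{n-1}^k structural: both
-- entries on the right lie at distance j - 1.
eDiag : ℕ → ℕ → ℤ
eDiag zero    k = + (k !)
eDiag (suc j) k = eDiag j (suc k) ℤ.- eDiag j k

-- e n k is e_n^k; the value is meaningful only for k ≤ n.
e : ℕ → ℕ → ℤ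
e n k = eDiag (n ∸ k) k

-- e-diagonal and e-step are the two defining equations of Euler's difference
-- table, and they determine e n k for all k ≤ n.
e-diagonal : ∀ n → e n n ≡ + (n !)
e-diagonal n = cong (λ j → eDiag j n) (ℕ.n∸n≡0 n)

e-step : ∀ n k → 1 ≤ k → k ≤ n → e n (k ∸ 1) ≡ e n k ℤ.- e (n ∸ 1) (k ∸ 1)
e-step (suc n) (suc k) _ (s≤s k≤n) = cong (λ j → eDiag j k) (ℕ.+-∸-assoc 1 k≤n)

d : ℕ → ℕ → ℚ
d n k = (e n k / (k !)) {{k ℕ.!≢0}}

fromℕ : ℕ → ℚ
fromℕ m = + m / 1

nCk≢0 : ∀ {n k} → k ≤ n → ℕ.NonZero (n C k)
nCk≢0 {n} {zero} _ =
  subst ℕ.NonZero (sym (trans (nCk≡nC[n∸k] {0} {n} z≤n) (nCn≡1 n))) _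
nCk≢0 {suc n} {suc k} (s≤s k≤n) =
  subst ℕ.NonZero (nCk+nC[k+1]≡[n+1]C[k+1] n k)
    (ℕ.>-nonZero (ℕ.<-≤-trans (ℕ.>-nonZero⁻¹ (n C k) {{nCk≢0 k≤n}}) (ℕ.m≤m+n (n C k) (n C suc k))))

fromℕ-nonZero : ∀ m → .{{ℕ.NonZero m}} → ℚ.NonZero (fromℕ m)
fromℕ-nonZero m = ℚ.pos⇒nonZero (fromℕ m) {{ℚ.normalize-pos m 1}}

-- d_n^k / binom(n,k); the bound k ≤ n is what makes the denominator nonzero.
d÷C : (n k : ℕ) → .(k ≤ n) → ℚ
d÷C n k k≤n = (d n k ÷ fromℕ (n C k)) {{fromℕ-nonZero (n C k) {{nCk≢0 k≤n}}}}

k≤n∸1⇒k≤n : ∀ {n k} → k ≤ n ∸ 1 → k ≤ n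
k≤n∸1⇒k≤n {n} k≤n∸1 = ℕ.≤-trans k≤n∸1 (ℕ.m∸n≤m n 1)

k≤n∸1⇒k∸1≤n : ∀ {n k} → k ≤ n ∸ 1 → k ∸ 1 ≤ n
k≤n∸1⇒k∸1≤n {n} {k} k≤n∸1 = ℕ.≤-trans (ℕ.m∸n≤m k 1) (k≤n∸1⇒k≤n k≤n∸1)

-- 1 ≤ k is needed: for n = k = 0 truncated subtraction satisfies k ≤ n ∸ 1.
k≤n∸1⇒k+1≤n : ∀ {n k} → 1 ≤ k → k ≤ n ∸ 1 → k ℕ.+ 1 ≤ n
k≤n∸1⇒k+1≤n {suc n} {k} _ k≤n = subst (_≤ suc n) (ℕ.+-comm 1 k) (s≤s k≤n)
k≤n∸1⇒k+1≤n {zero} (s≤s _) ()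

{-# OPTIONS --safe #-}
module Submission where

-- Along a column k, with j = n - k the distance from the diagonal, the entries E j = e_{k+j}^k
-- satisfy E (j+2) = (j+1) E j + (k+j+1) E (j+1) with E 0 = k! and E 1 = k k!.  This recurrence
-- has no subtraction, so the entries are natural numbers.  In terms of it, both inequalities
-- reduce to (j+1) (e_n^k)² ≤ (j+2) e_n^{k-1} e_n^{k+1} with n - k = j+1: use
-- d_n^k / binom(n,k) = (n-k)! e_n^k / n! for the first.

open import Defs
open import Data.Nat.Base using (ℕ; _+_; _∸_; _≤_; zero; suc; _!; NonZero)
import Data.Nat.Base as ℕ
import Data.Nat.Properties as ℕ
open import Data.Nat.Combinatorics using (_C_; nCk≡n!/k![n-k]!; k![n∸k]!∣n!)
open import Data.Nat.DivMod using (m/n*n≡m)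
open import Data.Nat.Tactic.RingSolver using (solve-∀)
import Data.Integer.Base as ℤ
import Data.Integer.Properties as ℤ
open import Data.Rational.Base using (ℚ; _*_; _≥_; _÷_; 1/_; _/_; toℚᵘ)
import Data.Rational.Base as ℚ
import Data.Rational.Properties as ℚ
open import Data.Rational.Unnormalised.Base using (mkℚᵘ; *≡*; *≤*)
import Data.Rational.Unnormalised.Base as ℚᵘ
import Data.Rational.Unnormalised.Properties as ℚᵘ
open import Algebra.Bundles using (module CommutativeMonoid)
import Algebra.Properties.CommutativeSemigroup as CommutativeSemigroupProperties
open import Data.Product.Base using (_×_; _,_)
open import Relation.Binary.PropositionalEquality
  using (_≡_; refl; sym; trans; cong; cong₂; subst; subst₂; module ≡-Reasoning)

private
  module ℚ-* = CommutativeSemigroupProperties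
    (CommutativeMonoid.commutativeSemigroup ℚ.*-1-commutativeMonoid)

-- The `j`-th forward difference of the factorial at `k`; it counts the permutations of `k + j`
-- elements that move each of `j` marked ones.
diff! : ℕ → ℕ → ℕ
diff! zero          k = k !
diff! (suc zero)    k = k ℕ.* k !
diff! (suc (suc j)) k = suc j ℕ.* diff! j k + suc (k + j) ℕ.* diff! (suc j) k

-- Euler's rule with the negative term moved across, so that it lives in the naturals. The induction
-- goes back two steps, as the recurrence does: both hypotheses carry column `suc k` to column `k`,
-- and a polynomial identity remains.
diff!-suc : ∀ j k → diff! j (suc k) ≡ diff! j k + diff! (suc j) k
diff!-suc zero          k = refl
diff!-suc (suc zero)    k = identity k (k !)
  where
  identity : ∀ k f → (1 + k) ℕ.* ((1 + k) ℕ.* f) ≡ k ℕ.* f + (1 ℕ.* f + (1 + (k + 0)) ℕ.* (k ℕ.* f))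
  identity = solve-∀
diff!-suc (suc (suc j)) k = trans
  (cong₂ (λ y z → suc j ℕ.* y + suc (suc k + j) ℕ.* z) (diff!-suc j k) (diff!-suc (suc j) k))
  (identity j k (diff! j k) (diff! (suc j) k))
  where
  identity : ∀ j k x w → let a = (1 + j) ℕ.* x + (1 + (k + j)) ℕ.* w in
    (1 + j) ℕ.* (x + w) + (2 + (k + j)) ℕ.* (w + a)
      ≡ a + ((2 + j) ℕ.* w + (1 + (k + (1 + j))) ℕ.* a)
  identity = solve-∀

-- Each step of `eDiag` subtracts one summand of `diff!-suc` and leaves the other.
eDiag≡diff! : ∀ j k → eDiag j k ≡ ℤ.+ diff! j k
eDiag≡diff! zero    k = refl
eDiag≡diff! (suc j) k = begin
  eDiag j (suc k) ℤ.- eDiag j k                   ≡⟨ cong₂ ℤ._-_ (eDiag≡diff! j (suc k)) (eDiag≡diff! j k) ⟩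
  ℤ.+ diff! j (suc k) ℤ.- ℤ.+ diff! j k           ≡⟨ cong (λ z → ℤ.+ z ℤ.- ℤ.+ diff! j k) (diff!-suc j k) ⟩
  ℤ.+ (diff! j k + diff! (suc j) k) ℤ.- ℤ.+ diff! j k ≡⟨ ℤ.m-n≡m⊖n (diff! j k + diff! (suc j) k) (diff! j k) ⟩
  (diff! j k + diff! (suc j) k) ℤ.⊖ diff! j k     ≡⟨ ℤ.⊖-≥ (ℕ.m≤m+n (diff! j k) (diff! (suc j) k)) ⟩
  ℤ.+ (diff! j k + diff! (suc j) k ∸ diff! j k)   ≡⟨ cong ℤ.+_ (ℕ.m+n∸m≡n (diff! j k) (diff! (suc j) k)) ⟩
  ℤ.+ diff! (suc j) k                             ∎
  where open ≡-Reasoning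

-- In terms of x = diff! j k and w = diff! (suc j) k every entry is linear in x and w,
-- and the difference of the two sides is a quadratic form with nonnegative coefficients.
diff!-logConvex : ∀ j k →
  suc j ℕ.* (diff! (suc j) (suc k) ℕ.* diff! (suc j) (suc k))
    ≤ suc (suc j) ℕ.* (diff! (suc (suc j)) k ℕ.* diff! j (suc (suc k)))
diff!-logConvex j k
  rewrite diff!-suc j (suc k) | diff!-suc (suc j) k | diff!-suc j k
  = bound j k (diff! j k) (diff! (suc j) k)
  where
  identity : ∀ j k x w →
    let a = (1 + j) ℕ.* x + (1 + (k + j)) ℕ.* w
        b = w + a in
    (1 + j) ℕ.* (b ℕ.* b)
      + ((1 + j) ℕ.* (2 ℕ.* j + 3) ℕ.* (x ℕ.* x)
        + (k ℕ.* (3 ℕ.* j + 4) + (2 + j) ℕ.* (3 ℕ.* j + 3)) ℕ.* (x ℕ.* w)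
        + (k ℕ.* k + 2 ℕ.* k ℕ.* (2 + j) + (2 + j) ℕ.* (1 + j)) ℕ.* (w ℕ.* w))
      ≡ (2 + j) ℕ.* (a ℕ.* ((x + w) + b))
  identity = solve-∀

  bound : ∀ j k x w →
    let a = (1 + j) ℕ.* x + (1 + (k + j)) ℕ.* w
        b = w + a in
    (1 + j) ℕ.* (b ℕ.* b) ≤ (2 + j) ℕ.* (a ℕ.* ((x + w) + b))
  bound j k x w =
    let b = w + ((1 + j) ℕ.* x + (1 + (k + j)) ℕ.* w)
        excess = (1 + j) ℕ.* (2 ℕ.* j + 3) ℕ.* (x ℕ.* x)
          + (k ℕ.* (3 ℕ.* j + 4) + (2 + j) ℕ.* (3 ℕ.* j + 3)) ℕ.* (x ℕ.* w)
          + (k ℕ.* k + 2 ℕ.* k ℕ.* (2 + j) + (2 + j) ℕ.* (1 + j)) ℕ.* (w ℕ.* w)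
    in ℕ.m+n≤o⇒m≤o ((1 + j) ℕ.* (b ℕ.* b)) {excess} (ℕ.≤-reflexive (identity j k x w))

-- `fromℕ` normalises, so the comparison is made in the unnormalised rationals, where equality is
-- cross-multiplication and no gcd appears.
fromℕ-homo-* : ∀ m n → fromℕ (m ℕ.* n) ≡ fromℕ m * fromℕ n
fromℕ-homo-* m n = ℚ.toℚᵘ-injective (begin
  toℚᵘ (fromℕ (m ℕ.* n))              ≈⟨ ℚ.toℚᵘ-fromℚᵘ (mkℚᵘ (ℤ.+ (m ℕ.* n)) 0) ⟩
  mkℚᵘ (ℤ.+ (m ℕ.* n)) 0              ≈⟨ *≡* (cong (ℤ._* ℤ.+ 1) (ℤ.pos-* m n)) ⟩
  mkℚᵘ (ℤ.+ m) 0 ℚᵘ.* mkℚᵘ (ℤ.+ n) 0  ≈⟨ ℚᵘ.*-cong (ℚ.toℚᵘ-fromℚᵘ (mkℚᵘ (ℤ.+ m) 0)) (ℚ.toℚᵘ-fromℚᵘ (mkℚᵘ (ℤ.+ n) 0)) ⟨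
  toℚᵘ (fromℕ m) ℚᵘ.* toℚᵘ (fromℕ n)  ≈⟨ ℚ.toℚᵘ-homo-* (fromℕ m) (fromℕ n) ⟨
  toℚᵘ (fromℕ m * fromℕ n)            ∎)
  where open import Relation.Binary.Reasoning.Setoid ℚᵘ.≃-setoid

i/n*n≡i : ∀ i n .{{_ : NonZero n}} → (i / n) * fromℕ n ≡ i / 1
-- `mkℚᵘ` stores the denominator less one, hence the successor pattern.
i/n*n≡i i n@(suc n-1) = ℚ.toℚᵘ-injective (begin
  toℚᵘ ((i / n) * fromℕ n)            ≈⟨ ℚ.toℚᵘ-homo-* (i / n) (fromℕ n) ⟩
  toℚᵘ (i / n) ℚᵘ.* toℚᵘ (fromℕ n)    ≈⟨ ℚᵘ.*-cong (ℚ.toℚᵘ-fromℚᵘ (mkℚᵘ i n-1)) (ℚ.toℚᵘ-fromℚᵘ (mkℚᵘ (ℤ.+ n) 0)) ⟩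
  mkℚᵘ i n-1 ℚᵘ.* mkℚᵘ (ℤ.+ n) 0      ≈⟨ *≡* (trans (ℤ.*-identityʳ _) (cong (λ m → i ℤ.* ℤ.+ m) (sym (ℕ.*-identityʳ n)))) ⟩
  mkℚᵘ i 0                            ≈⟨ ℚ.toℚᵘ-fromℚᵘ (mkℚᵘ i 0) ⟨
  toℚᵘ (i / 1)                        ∎)
  where open import Relation.Binary.Reasoning.Setoid ℚᵘ.≃-setoid

p÷q*q≡p : ∀ p q .{{_ : ℚ.NonZero q}} → (p ÷ q) * q ≡ p
p÷q*q≡p p q = trans (ℚ.*-assoc p (1/ q) q)
  (trans (cong (p *_) (ℚ.*-inverseˡ q)) (ℚ.*-identityʳ p))

fromℕ-mono-≤ : ∀ {m n} → m ≤ n → fromℕ m ℚ.≤ fromℕ n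
fromℕ-mono-≤ {m} {n} m≤n = ℚ.toℚᵘ-cancel-≤ (begin
  toℚᵘ (fromℕ m)  ≃⟨ ℚ.toℚᵘ-fromℚᵘ (mkℚᵘ (ℤ.+ m) 0) ⟩
  mkℚᵘ (ℤ.+ m) 0  ≤⟨ *≤* (ℤ.*-monoʳ-≤-nonNeg (ℤ.+ 1) (ℤ.+≤+ m≤n)) ⟩
  mkℚᵘ (ℤ.+ n) 0  ≃⟨ ℚ.toℚᵘ-fromℚᵘ (mkℚᵘ (ℤ.+ n) 0) ⟨
  toℚᵘ (fromℕ n)  ∎)
  where open ℚᵘ.≤-Reasoning

-- A record, because a and s cannot be inferred from the bare equation: fromℕ unfolds to a normalised fraction.
record IsRatio (p : ℚ) (a s : ℕ) : Set where
  constructor ratio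
  field p*s≡a : p * fromℕ s ≡ fromℕ a

open IsRatio

isRatio-resp : ∀ {p q a s} → p ≡ q → IsRatio p a s → IsRatio q a s
isRatio-resp refl p≈a/s = p≈a/s

-- Only fractions over one denominator are compared; `isRatio-expand` and `isRatio-cancel` serve to
-- reach it.
isRatio-≤ : ∀ {p q a b s} .{{_ : NonZero s}} → IsRatio p a s → IsRatio q b s → a ≤ b → p ℚ.≤ q
isRatio-≤ {s = s} p≈a/s q≈b/s a≤b = ℚ.*-cancelʳ-≤-pos (fromℕ s) {{ℚ.normalize-pos s 1}}
  (subst₂ ℚ._≤_ (sym (p*s≡a p≈a/s)) (sym (p*s≡a q≈b/s)) (fromℕ-mono-≤ a≤b))

isRatio-* : ∀ {p q a b s t} → IsRatio p a s → IsRatio q b t → IsRatio (p * q) (a ℕ.* b) (s ℕ.* t)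
isRatio-* {p} {q} {a} {b} {s} {t} p≈a/s q≈b/t .p*s≡a = begin
  (p * q) * fromℕ (s ℕ.* t)        ≡⟨ cong ((p * q) *_) (fromℕ-homo-* s t) ⟩
  (p * q) * (fromℕ s * fromℕ t)    ≡⟨ ℚ-*.interchange p q (fromℕ s) (fromℕ t) ⟩
  (p * fromℕ s) * (q * fromℕ t)    ≡⟨ cong₂ _*_ (p*s≡a p≈a/s) (p*s≡a q≈b/t) ⟩
  fromℕ a * fromℕ b                ≡⟨ fromℕ-homo-* a b ⟨
  fromℕ (a ℕ.* b)                  ∎
  where open ≡-Reasoning

isRatio-scale : ∀ {p a s} c → IsRatio p a s → IsRatio (fromℕ c * p) (c ℕ.* a) s
isRatio-scale {p} {a} {s} c p≈a/s .p*s≡a = begin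
  (fromℕ c * p) * fromℕ s  ≡⟨ ℚ.*-assoc (fromℕ c) p (fromℕ s) ⟩
  fromℕ c * (p * fromℕ s)  ≡⟨ cong (fromℕ c *_) (p*s≡a p≈a/s) ⟩
  fromℕ c * fromℕ a        ≡⟨ fromℕ-homo-* c a ⟨
  fromℕ (c ℕ.* a)          ∎
  where open ≡-Reasoning

isRatio-expand : ∀ {p a s} c → IsRatio p a s → IsRatio p (c ℕ.* a) (c ℕ.* s)
isRatio-expand {p} {a} {s} c p≈a/s .p*s≡a = begin
  p * fromℕ (c ℕ.* s)        ≡⟨ cong (p *_) (fromℕ-homo-* c s) ⟩
  p * (fromℕ c * fromℕ s)    ≡⟨ ℚ-*.x∙yz≈yx∙z p (fromℕ c) (fromℕ s) ⟩
  (fromℕ c * p) * fromℕ s    ≡⟨ p*s≡a (isRatio-scale c p≈a/s) ⟩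
  fromℕ (c ℕ.* a)            ∎
  where open ≡-Reasoning

isRatio-cancel : ∀ {p a s} c → IsRatio p a (c ℕ.* s) → IsRatio (fromℕ c * p) a s
isRatio-cancel {p} {a} {s} c p≈a/cs .p*s≡a = begin
  (fromℕ c * p) * fromℕ s    ≡⟨ ℚ-*.xy∙z≈y∙xz (fromℕ c) p (fromℕ s) ⟩
  p * (fromℕ c * fromℕ s)    ≡⟨ cong (p *_) (fromℕ-homo-* c s) ⟨
  p * fromℕ (c ℕ.* s)        ≡⟨ p*s≡a p≈a/cs ⟩
  fromℕ a                    ∎
  where open ≡-Reasoning

isRatio-÷ : ∀ {p a s} c .{{_ : ℚ.NonZero (fromℕ c)}} → IsRatio p a s → IsRatio (p ÷ fromℕ c) a (c ℕ.* s)
isRatio-÷ {p} {a} {s} c p≈a/s .p*s≡a = begin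
  (p ÷ fromℕ c) * fromℕ (c ℕ.* s)      ≡⟨ cong ((p ÷ fromℕ c) *_) (fromℕ-homo-* c s) ⟩
  (p ÷ fromℕ c) * (fromℕ c * fromℕ s)  ≡⟨ ℚ.*-assoc (p ÷ fromℕ c) (fromℕ c) (fromℕ s) ⟨
  (p ÷ fromℕ c) * fromℕ c * fromℕ s    ≡⟨ cong (_* fromℕ s) (p÷q*q≡p p (fromℕ c)) ⟩
  p * fromℕ s                          ≡⟨ p*s≡a p≈a/s ⟩
  fromℕ a                              ∎
  where open ≡-Reasoning

d-isRatio : ∀ n k → IsRatio (d n k) (diff! (n ∸ k) k) (k !)
d-isRatio n k .p*s≡a = trans (i/n*n≡i (e n k) (k !) {{k ℕ.!≢0}})
  (cong (λ i → i / 1) (eDiag≡diff! (n ∸ k) k))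

-- The factors stand in the order in which `isRatio-expand` followed by `isRatio-÷` produces them.
nCk*[[n∸k]!*k!]≡n! : ∀ {n k} → k ≤ n → (n C k) ℕ.* ((n ∸ k) ! ℕ.* k !) ≡ n !
nCk*[[n∸k]!*k!]≡n! {n} {k} k≤n = trans
  (cong₂ ℕ._*_ (nCk≡n!/k![n-k]! k≤n) (ℕ.*-comm ((n ∸ k) !) (k !)))
  (m/n*n≡m {{k ℕ.!* (n ∸ k) !≢0}} (k![n∸k]!∣n! k≤n))

-- Expanding by `(n ∸ k) !` before dividing by the binomial makes the denominator independent of
-- `k`, so all quotients in the theorem share it.
d÷C-isRatio : ∀ n k (k≤n : k ≤ n) → IsRatio (d÷C n k k≤n) ((n ∸ k) ! ℕ.* diff! (n ∸ k) k) (n !)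
d÷C-isRatio n k k≤n = subst (IsRatio (d÷C n k k≤n) ((n ∸ k) ! ℕ.* diff! (n ∸ k) k))
  (nCk*[[n∸k]!*k!]≡n! k≤n)
  (isRatio-÷ (n C k) {{fromℕ-nonZero (n C k) {{nCk≢0 k≤n}}}} (isRatio-expand ((n ∸ k) !) (d-isRatio n k)))

theorem3p1 : (n k : ℕ) (1≤k : 1 ≤ k) (k≤n∸1 : k ≤ n ∸ 1) →
    (d÷C n (k ∸ 1) (k≤n∸1⇒k∸1≤n k≤n∸1) * d÷C n (k + 1) (k≤n∸1⇒k+1≤n 1≤k k≤n∸1)
    ≥ d÷C n k (k≤n∸1⇒k≤n k≤n∸1) * d÷C n k (k≤n∸1⇒k≤n k≤n∸1))
    × (fromℕ (n ∸ k + 1) * fromℕ (k + 1) * d n (k ∸ 1) * d n (k + 1)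
    ≥ fromℕ k * fromℕ (n ∸ k) * (d n k * d n k))
-- Here `j` is n - 1 - k, so the columns k - 1, k, k + 1 of row n lie at distances j + 2, j + 1, j
-- from the diagonal.
theorem3p1 (suc n-1) (suc m) 1≤k k≤n∸1 with ℕ.m≤n⇒∃[o]m+o≡n k≤n∸1
... | j , refl =
    isRatio-≤ {{ℕ.m*n≢0 (n !) (n !) {{n ℕ.!≢0}} {{n ℕ.!≢0}}}}
      (isRatio-* d÷C-k d÷C-k) (isRatio-* d÷C-m d÷C-k+1) ratio-bound
  , isRatio-≤ {{ℕ.m*n≢0 (k !) (k !) {{k ℕ.!≢0}} {{k ℕ.!≢0}}}}
      (isRatio-resp (cong (_* (d n k * d n k)) (fromℕ-homo-* k (n ∸ k)))
        (isRatio-scale (k ℕ.* (n ∸ k)) (isRatio-* (d-isRatio n k) (d-isRatio n k))))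
      (isRatio-resp (sym regroup)
        -- Expanding by `k` turns the denominator `m !` of `d n m` into `k !`.
        (isRatio-* (isRatio-scale (n ∸ k + 1) (isRatio-expand k (d-isRatio n m))) [k+1]d-k+1))
      cleared-bound
  where
  k = suc m
  n = suc (k + j)
  A = diff! (suc (suc j)) m
  B = diff! (suc j) k
  C = diff! j (suc k)

  n∸m≡ : n ∸ m ≡ suc (suc j)
  n∸m≡ = trans
    (cong (_∸ m) (sym (trans (ℕ.+-suc m (suc j)) (cong suc (ℕ.+-suc m j)))))
    (ℕ.m+n∸m≡n m (suc (suc j)))

  n∸k≡ : n ∸ k ≡ suc j
  n∸k≡ = trans (cong (_∸ m) (sym (ℕ.+-suc m j))) (ℕ.m+n∸m≡n m (suc j))

  k+1≡ : k + 1 ≡ suc k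
  k+1≡ = ℕ.+-comm k 1

  n∸[k+1]≡ : n ∸ (k + 1) ≡ j
  n∸[k+1]≡ = trans (cong (n ∸_) k+1≡) (ℕ.m+n∸m≡n k j)

  d÷C-m   = d÷C-isRatio n m (k≤n∸1⇒k∸1≤n k≤n∸1)
  d÷C-k   = d÷C-isRatio n k (k≤n∸1⇒k≤n k≤n∸1)
  d÷C-k+1 = d÷C-isRatio n (k + 1) (k≤n∸1⇒k+1≤n 1≤k k≤n∸1)

  ratio-bound :
    ((n ∸ k) ! ℕ.* diff! (n ∸ k) k) ℕ.* ((n ∸ k) ! ℕ.* diff! (n ∸ k) k)
      ≤ ((n ∸ m) ! ℕ.* diff! (n ∸ m) m) ℕ.* ((n ∸ (k + 1)) ! ℕ.* diff! (n ∸ (k + 1)) (k + 1))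
  ratio-bound rewrite n∸k≡ | n∸m≡ | n∸[k+1]≡ | k+1≡ = subst₂ _≤_ (lhs j (j !) B) (rhs j (j !) A C)
    -- The factor (j+1)! j! completes j + 1 to (j+1)! squared on the left and j + 2 to (j+2)! j! on
    -- the right.
    (ℕ.*-monoʳ-≤ (suc j ! ℕ.* j !) (diff!-logConvex j m))
    where
    lhs : ∀ j f b → ((1 + j) ℕ.* f ℕ.* f) ℕ.* ((1 + j) ℕ.* (b ℕ.* b))
      ≡ (((1 + j) ℕ.* f) ℕ.* b) ℕ.* (((1 + j) ℕ.* f) ℕ.* b)
    lhs = solve-∀
    rhs : ∀ j f a c → ((1 + j) ℕ.* f ℕ.* f) ℕ.* ((2 + j) ℕ.* (a ℕ.* c))
      ≡ (((2 + j) ℕ.* ((1 + j) ℕ.* f)) ℕ.* a) ℕ.* (f ℕ.* c)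
    rhs = solve-∀

  [k+1]d-k+1 : IsRatio (fromℕ (k + 1) * d n (k + 1)) (diff! (n ∸ (k + 1)) (k + 1)) (k !)
  -- The factorial of `k + 1` does not unfold; at `suc k` it is `suc k` times `k !` by definition,
  -- and the scaling factor cancels.
  [k+1]d-k+1 = subst (λ l → IsRatio (fromℕ l * d n l) (diff! (n ∸ l) l) (k !)) (sym k+1≡)
    (isRatio-cancel (suc k) (d-isRatio n (suc k)))

  regroup : fromℕ (n ∸ k + 1) * fromℕ (k + 1) * d n m * d n (k + 1)
    ≡ (fromℕ (n ∸ k + 1) * d n m) * (fromℕ (k + 1) * d n (k + 1))
  regroup = trans
    (ℚ.*-assoc (fromℕ (n ∸ k + 1) * fromℕ (k + 1)) (d n m) (d n (k + 1)))
    (ℚ-*.interchange (fromℕ (n ∸ k + 1)) (fromℕ (k + 1)) (d n m) (d n (k + 1)))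

  cleared-bound : (k ℕ.* (n ∸ k)) ℕ.* (diff! (n ∸ k) k ℕ.* diff! (n ∸ k) k)
    ≤ ((n ∸ k + 1) ℕ.* (k ℕ.* diff! (n ∸ m) m)) ℕ.* diff! (n ∸ (k + 1)) (k + 1)
  cleared-bound rewrite n∸k≡ | n∸m≡ | n∸[k+1]≡ | k+1≡ = subst₂ _≤_ (lhs k j B) (rhs k j A C)
    -- On the left `k` is the coefficient in the statement; on the right it comes from expanding
    -- `d n m`.
    (ℕ.*-monoʳ-≤ k (diff!-logConvex j m))
    where
    lhs : ∀ k j b → k ℕ.* ((1 + j) ℕ.* (b ℕ.* b)) ≡ (k ℕ.* (1 + j)) ℕ.* (b ℕ.* b)
    lhs = solve-∀
    rhs : ∀ k j a c → k ℕ.* ((2 + j) ℕ.* (a ℕ.* c)) ≡ ((1 + j + 1) ℕ.* (k ℕ.* a)) ℕ.* c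
    rhs = solve-∀
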